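{- $C_3^{*}$ is the only nontrivial uniquely $C_4^{+}$-saturated graph with exactly one triangle (up to isomorphism).
   Context: All graphs are finite, simple and undirected. $C_4^{+}$ (the diamond) is the graph obtained from a $4$-cycle by adding one chord, i.e. $K_4$ minus an edge. $C_3^{*}$ is the graph consisting of a triangle with one pendant edge attached. For a graph $H$, a graph $G$ is uniquely $H$-saturated if $G$ contains no subgraph isomorphic to $H$, but for every pair of non-adjacent vertices $u,v$ of $G$, the graph $G+uv$ contains exactly one subgraph isomorphic to $H$. A uniquely $H$-saturated graph is nontrivial if it has at least $|V(H)|$ vertices. A triangle is a subgraph isomorphic to $K_3$. -}

module Defs where

open import Data.Nat using (ℕ; _≤_)
open import Data.Fin using (Fin; zero; suc)
open import Data.Bool using (Bool; true; false)
open import Data.Product using (Σ; ∃; _×_; _,_)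
open import Data.Sum using (_⊎_)
open import Relation.Nullary using (¬_)
open import Relation.Binary.PropositionalEquality using (_≡_; _≢_)
open import Function.Bundles using (_⇔_; _↔_)
open import Function.Bundles using (Inverse)

record Graph (n : ℕ) : Set where
  field
    adj    : Fin n → Fin n → Bool
    sym    : ∀ i j → adj i j ≡ adj j i
    irrefl : ∀ i → adj i i ≡ false
open Graph public

Adj : ∀ {n} → Graph n → Fin n → Fin n → Set
Adj G i j = adj G i j ≡ true

SamePair : ∀ {n} → Fin n → Fin n → Fin n → Fin n → Set
SamePair p q u v = (p ≡ u × q ≡ v) ⊎ (p ≡ v × q ≡ u)

AddEdge : ∀ {n} → (Fin n → Fin n → Set) → Fin n → Fin n → Fin n → Fin n → Set
AddEdge R u v p q = R p q ⊎ SamePair p q u v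

-- Diamonds (C₄⁺ = K₄ minus an edge).
-- A copy of C₄⁺ in a graph with adjacency R is given by four distinct
-- vertices (a , b , c , d) with edges ab, ac, ad, bc, bd
-- (ab is the chord, c and d are the two degree-2 vertices; cd need not
-- be absent, since we count subgraphs, not induced subgraphs).

record DiamondIn {n} (R : Fin n → Fin n → Set) : Set where
  constructor diamond
  field
    a b c d : Fin n
    ab : a ≢ b
    ac : a ≢ c
    ad : a ≢ d
    bc : b ≢ c
    bd : b ≢ d
    cd : c ≢ d
    eab : R a b
    eac : R a c
    ead : R a d
    ebc : R b c
    ebd : R b d

DiamondEdge : ∀ {n} {R : Fin n → Fin n → Set} → DiamondIn R → Fin n → Fin n → Set
DiamondEdge D p q =
  SamePair p q a b ⊎ SamePair p q a c ⊎ SamePair p q a d ⊎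
  SamePair p q b c ⊎ SamePair p q b d
  where open DiamondIn D

-- Two diamond copies are the same subgraph iff they have the same edge set
-- (the vertex set of a diamond is determined by its edges).
SameSubgraph : ∀ {n} {R : Fin n → Fin n → Set} → DiamondIn R → DiamondIn R → Set
SameSubgraph D D′ = ∀ p q → DiamondEdge D p q ⇔ DiamondEdge D′ p q

ExactlyOneDiamond : ∀ {n} → (Fin n → Fin n → Set) → Set
ExactlyOneDiamond R = Σ (DiamondIn R) λ D → ∀ (D′ : DiamondIn R) → SameSubgraph D D′

DiamondFree : ∀ {n} → Graph n → Set
DiamondFree G = ¬ DiamondIn (Adj G)

UniquelyDiamondSaturated : ∀ {n} → Graph n → Set
UniquelyDiamondSaturated G =
  DiamondFree G ×
  (∀ u v → u ≢ v → ¬ Adj G u v → ExactlyOneDiamond (AddEdge (Adj G) u v))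

-- Nontrivial: at least |V(C₄⁺)| = 4 vertices.
Nontrivial : ∀ {n} → Graph n → Set
Nontrivial {n} G = 4 ≤ n

record TriangleIn {n} (G : Graph n) : Set where
  constructor triangle
  field
    x y z : Fin n
    exy : Adj G x y
    exz : Adj G x z
    eyz : Adj G y z

SameTriangle : ∀ {n} {G : Graph n} → TriangleIn G → TriangleIn G → Set
SameTriangle T T′ = ∀ w → (w ≡ x ⊎ w ≡ y ⊎ w ≡ z) ⇔ (w ≡ x′ ⊎ w ≡ y′ ⊎ w ≡ z′)
  where
  open TriangleIn T
  open TriangleIn T′ renaming (x to x′; y to y′; z to z′; exy to exy′; exz to exz′; eyz to eyz′)

ExactlyOneTriangle : ∀ {n} → Graph n → Set
ExactlyOneTriangle G = Σ (TriangleIn G) λ T → ∀ (T′ : TriangleIn G) → SameTriangle T T′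

_≅_ : ∀ {n m} → Graph n → Graph m → Set
G ≅ H = Σ (Inverse _ _) λ (f : Fin _ ↔ Fin _) →
          ∀ i j → adj H (Inverse.to f i) (Inverse.to f j) ≡ adj G i j

-- C₃* : triangle 0,1,2 with pendant edge 2–3.

c3*-adj : Fin 4 → Fin 4 → Bool
c3*-adj zero (suc zero) = true
c3*-adj zero (suc (suc zero)) = true
c3*-adj (suc zero) zero = true
c3*-adj (suc zero) (suc (suc zero)) = true
c3*-adj (suc (suc zero)) zero = true
c3*-adj (suc (suc zero)) (suc zero) = true
c3*-adj (suc (suc zero)) (suc (suc (suc zero))) = true
c3*-adj (suc (suc (suc zero))) (suc (suc zero)) = true
c3*-adj _ _ = false

c3*-sym : ∀ i j → c3*-adj i j ≡ c3*-adj j i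
c3*-sym zero zero = _≡_.refl
c3*-sym zero (suc zero) = _≡_.refl
c3*-sym zero (suc (suc zero)) = _≡_.refl
c3*-sym zero (suc (suc (suc zero))) = _≡_.refl
c3*-sym (suc zero) zero = _≡_.refl
c3*-sym (suc zero) (suc zero) = _≡_.refl
c3*-sym (suc zero) (suc (suc zero)) = _≡_.refl
c3*-sym (suc zero) (suc (suc (suc zero))) = _≡_.refl
c3*-sym (suc (suc zero)) zero = _≡_.refl
c3*-sym (suc (suc zero)) (suc zero) = _≡_.refl
c3*-sym (suc (suc zero)) (suc (suc zero)) = _≡_.refl
c3*-sym (suc (suc zero)) (suc (suc (suc zero))) = _≡_.refl
c3*-sym (suc (suc (suc zero))) zero = _≡_.refl
c3*-sym (suc (suc (suc zero))) (suc zero) = _≡_.refl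
c3*-sym (suc (suc (suc zero))) (suc (suc zero)) = _≡_.refl
c3*-sym (suc (suc (suc zero))) (suc (suc (suc zero))) = _≡_.refl

c3*-irrefl : ∀ i → c3*-adj i i ≡ false
c3*-irrefl zero = _≡_.refl
c3*-irrefl (suc zero) = _≡_.refl
c3*-irrefl (suc (suc zero)) = _≡_.refl
c3*-irrefl (suc (suc (suc zero))) = _≡_.refl

C3* : Graph 4
C3* = record { adj = c3*-adj ; sym = c3*-sym ; irrefl = c3*-irrefl }

{-# OPTIONS --safe #-}

-- Let xyz be the unique triangle and write N(t) for the set of neighbours of
-- t ∈ {x,y,z} outside it.  A diamond created by a new edge uv either has uv as
-- its chord, which happens when u and v have exactly two common neighbours, or
-- contains a triangle of G through u or v that meets the neighbourhood of the
-- other end.  Hence for u ∈ N(x) the only common neighbour of u and y is x, and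
-- two non-adjacent vertices outside the triangle have exactly two common
-- neighbours.
-- Fix u ∈ N(x) and let A be the set of its neighbours other than x.
-- Counting the edges between A and N(x) ∖ {u} gives |A| = |N(x)| − 1, and
-- counting those between A and N(y) gives 2|A| = 2|N(y)|.  So a nonempty N(x)
-- satisfies |N(x)| = |N(y)| + 1; by symmetry N(x) and N(y) are not both
-- nonempty, and a nonempty N(x) is a singleton.  A vertex with no neighbour on
-- the triangle would make every N(t) nonempty, so there is none.

module Submission where

open import Defs
open import Data.Nat using (ℕ; suc; _+_; _*_; _≤_; s≤s; z≤n)
open import Data.Nat.Properties using (+-*-semiring; *-cancelʳ-≡; suc-injective; m≢1+n+m; 1+n≰n; ≤-trans)
open import Data.Fin using (Fin; zero; suc; _≟_)
open import Data.Fin.Patterns using (0F; 1F; 2F; 3F)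
open import Data.Fin.Properties using (all?; any?; injective⇒≤)
open import Data.Bool using (true; false)
import Data.Bool.Properties as Bool
open import Data.Product using (∃; ∃₂; _×_; _,_; proj₁; proj₂)
open import Data.Sum using (_⊎_; inj₁; inj₂; swap; [_,_]′)
open import Data.Vec using (lookup; _∷_; [])
open import Function using (_∘_; mk⇔; mk↔ₛ′; Equivalence)
open import Relation.Nullary using (¬_; Dec; yes; no; contradiction; _×-dec_; _⊎-dec_; _→-dec_; ¬?)
open import Relation.Nullary.Decidable using (toWitness; toWitnessFalse)
open import Relation.Unary using (Pred; Decidable)
open import Relation.Binary.PropositionalEquality as ≡ using (_≡_; _≢_; refl; cong; cong₂; subst; ≢-sym; module ≡-Reasoning)
open import Algebra.Properties.Semiring.Sum +-*-semiring using (sum; sum-cong-≗; sum-replicate-zero; ∑-distrib-+; ∑-comm; *-distribˡ-sum; *-distribʳ-sum)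
open import Level using (0ℓ)

open Equivalence using (to; from)

-- Counting decidable subsets of Fin n

indicator : {A : Set} → Dec A → ℕ
indicator (yes _) = 1
indicator (no  _) = 0

indicator-cong : {A B : Set} (A? : Dec A) (B? : Dec B) → (A → B) → (B → A) → indicator A? ≡ indicator B?
indicator-cong (yes _) (yes _) _ _ = refl
indicator-cong (yes a) (no ¬b) f _ = contradiction (f a) ¬b
indicator-cong (no ¬a) (yes b) _ g = contradiction (g b) ¬a
indicator-cong (no _)  (no _)  _ _ = refl

indicator-× : {A B : Set} (A? : Dec A) (B? : Dec B) → indicator (A? ×-dec B?) ≡ indicator A? * indicator B?
indicator-× (yes _) (yes _) = refl
indicator-× (yes _) (no _)  = refl
indicator-× (no _)  _       = refl

module _ {n : ℕ} {P : Pred (Fin n) 0ℓ} (P? : Decidable P) where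

  count : ℕ
  count = sum (λ i → indicator (P? i))

  count-none : (∀ i → ¬ P i) → count ≡ 0
  count-none ¬P = ≡.trans (sum-cong-≗ zeros) (sum-replicate-zero n)
    where
    zeros : ∀ i → indicator (P? i) ≡ 0
    zeros i with P? i
    ... | yes p = contradiction p (¬P i)
    ... | no  _ = refl

count-cong : ∀ {n} {P Q : Pred (Fin n) 0ℓ} (P? : Decidable P) (Q? : Decidable Q) →
             (∀ {i} → P i → Q i) → (∀ {i} → Q i → P i) → count P? ≡ count Q?
count-cong P? Q? f g = sum-cong-≗ (λ i → indicator-cong (P? i) (Q? i) f g)

count-point : ∀ {n} (a : Fin n) → count (_≟ a) ≡ 1
count-point {suc n} zero    = cong suc (count-none {n} (λ i → suc i ≟ zero) (λ _ ()))
count-point {suc n} (suc a) =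
  ≡.trans (count-cong {n} (λ i → suc i ≟ suc a) (_≟ a) (λ { refl → refl }) (λ { refl → refl })) (count-point a)

infixl 8 _∖_
_∖_ : ∀ {n} {P : Pred (Fin n) 0ℓ} → Decidable P → ∀ a → Decidable (λ i → P i × i ≢ a)
(P? ∖ a) i = P? i ×-dec ¬? (i ≟ a)

module _ {n : ℕ} {P : Pred (Fin n) 0ℓ} (P? : Decidable P) where

  count-remove : ∀ {a} → P a → count P? ≡ suc (count (P? ∖ a))
  count-remove {a} pa = begin
    count P?                                                  ≡⟨ sum-cong-≗ split ⟩
    sum (λ i → indicator (i ≟ a) + indicator ((P? ∖ a) i))       ≡⟨ ∑-distrib-+ (λ i → indicator (i ≟ a)) _ ⟩
    count (_≟ a) + count (P? ∖ a)                              ≡⟨ cong (_+ count (P? ∖ a)) (count-point a) ⟩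
    suc (count (P? ∖ a))                                       ∎
    where
    open ≡-Reasoning
    split : ∀ i → indicator (P? i) ≡ indicator (i ≟ a) + indicator ((P? ∖ a) i)
    split i with P? i | i ≟ a
    ... | yes _ | yes _    = refl
    ... | yes _ | no _     = refl
    ... | no ¬p | yes refl = contradiction pa ¬p
    ... | no _  | no _     = refl

  count≡0⇒empty : count P? ≡ 0 → ∀ i → ¬ P i
  count≡0⇒empty eq i p with () ← ≡.trans (≡.sym eq) (count-remove p)

  count≡suc⇒∃ : ∀ {k} → count P? ≡ suc k → ∃ P
  count≡suc⇒∃ eq with any? P?
  ... | yes p = p
  ... | no ¬p with () ← ≡.trans (≡.sym eq) (count-none P? (λ i p → ¬p (i , p)))

count-two : ∀ {n} {P : Pred (Fin n) 0ℓ} (P? : Decidable P) {a b} →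
            a ≢ b → P a → P b → (∀ i → P i → i ≡ a ⊎ i ≡ b) → count P? ≡ 2
count-two P? {a} {b} a≢b pa pb only =
  ≡.trans (count-remove P? pa) (cong suc
    (≡.trans (count-remove (P? ∖ a) (pb , ≢-sym a≢b)) (cong suc
      (count-none (P? ∖ a ∖ b) λ i ((p , i≢a) , i≢b) → [ i≢a , i≢b ]′ (only i p)))))

-- Both sides count the pairs `(i, j)` with `P i`, `Q j` and `R i j`, once by rows and once by
-- columns.
double-count : ∀ {m n} {P : Pred (Fin m) 0ℓ} {Q : Pred (Fin n) 0ℓ} {R : Fin m → Fin n → Set}
               (P? : Decidable P) (Q? : Decidable Q) (R? : ∀ i j → Dec (R i j)) {k l : ℕ} →
               (∀ i → P i → count (λ j → Q? j ×-dec R? i j) ≡ k) →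
               (∀ j → Q j → count (λ i → P? i ×-dec R? i j) ≡ l) →
               count P? * k ≡ count Q? * l
double-count {P = P} {Q} P? Q? R? {k} {l} rows cols = begin
  count P? * k                                                        ≡⟨ weigh P? (λ i j → indicator (Q? j ×-dec R? i j)) rows ⟩
  sum (λ i → sum (λ j → indicator (P? i) * indicator (Q? j ×-dec R? i j))) ≡⟨ ∑-comm (λ i j → indicator (P? i) * indicator (Q? j ×-dec R? i j)) ⟩
  sum (λ j → sum (λ i → indicator (P? i) * indicator (Q? j ×-dec R? i j))) ≡⟨ sum-cong-≗ (λ j → sum-cong-≗ (λ i → exchange (P? i) (Q? j) (R? i j))) ⟩
  sum (λ j → sum (λ i → indicator (Q? j) * indicator (P? i ×-dec R? i j))) ≡⟨ weigh Q? (λ j i → indicator (P? i ×-dec R? i j)) cols ⟨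
  count Q? * l                                                        ∎
  where
  open ≡-Reasoning

  weigh : ∀ {m n} {P : Pred (Fin m) 0ℓ} (P? : Decidable P) (f : Fin m → Fin n → ℕ) {k} →
          (∀ i → P i → sum (f i) ≡ k) → count P? * k ≡ sum (λ i → sum (λ j → indicator (P? i) * f i j))
  weigh P? f {k} h = ≡.trans (*-distribʳ-sum k (λ i → indicator (P? i))) (sum-cong-≗ row)
    where
    weight : ∀ i → indicator (P? i) * k ≡ indicator (P? i) * sum (f i)
    weight i with P? i
    ... | yes p = cong (1 *_) (≡.sym (h i p))
    ... | no _  = refl
    row : ∀ i → indicator (P? i) * k ≡ sum (λ j → indicator (P? i) * f i j)
    row i = ≡.trans (weight i) (*-distribˡ-sum (indicator (P? i)) (f i))

  exchange : {A B C : Set} (A? : Dec A) (B? : Dec B) (C? : Dec C) →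
             indicator A? * indicator (B? ×-dec C?) ≡ indicator B? * indicator (A? ×-dec C?)
  exchange A? B? C? = begin
    indicator A? * indicator (B? ×-dec C?)  ≡⟨ indicator-× A? (B? ×-dec C?) ⟨
    indicator (A? ×-dec (B? ×-dec C?))      ≡⟨ indicator-cong (A? ×-dec (B? ×-dec C?)) (B? ×-dec (A? ×-dec C?)) (λ (a , b , c) → b , a , c) (λ (b , a , c) → a , b , c) ⟩
    indicator (B? ×-dec (A? ×-dec C?))      ≡⟨ indicator-× B? (A? ×-dec C?) ⟩
    indicator B? * indicator (A? ×-dec C?)  ∎

-- Diamonds created by an added edge

sameSubgraph : ∀ {n} {R : Fin n → Fin n → Set} → ExactlyOneDiamond R → (D D′ : DiamondIn R) →
               ∀ p q → DiamondEdge D p q → DiamondEdge D′ p q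
sameSubgraph (_ , unique) D D′ p q e = to (unique D′ p q) (from (unique D p q) e)

SamePair-sym : ∀ {n} {p q u v : Fin n} → SamePair p q u v → SamePair q p u v
SamePair-sym (inj₁ (p , q)) = inj₂ (q , p)
SamePair-sym (inj₂ (p , q)) = inj₁ (q , p)

-- Serves to tell two diamonds apart: an edge of one that ends outside the vertices of the other
-- cannot be shared.
diamondEdge-end : ∀ {n} {R : Fin n → Fin n → Set} (D : DiamondIn R) {p q} → let open DiamondIn D in
                  DiamondEdge D p q → q ≡ a ⊎ q ≡ b ⊎ q ≡ c ⊎ q ≡ d
diamondEdge-end D (inj₁ (inj₁ (_ , e)))                      = inj₂ (inj₁ e)
diamondEdge-end D (inj₁ (inj₂ (_ , e)))                      = inj₁ e
diamondEdge-end D (inj₂ (inj₁ (inj₁ (_ , e))))               = inj₂ (inj₂ (inj₁ e))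
diamondEdge-end D (inj₂ (inj₁ (inj₂ (_ , e))))               = inj₁ e
diamondEdge-end D (inj₂ (inj₂ (inj₁ (inj₁ (_ , e)))))        = inj₂ (inj₂ (inj₂ e))
diamondEdge-end D (inj₂ (inj₂ (inj₁ (inj₂ (_ , e)))))        = inj₁ e
diamondEdge-end D (inj₂ (inj₂ (inj₂ (inj₁ (inj₁ (_ , e)))))) = inj₂ (inj₂ (inj₁ e))
diamondEdge-end D (inj₂ (inj₂ (inj₂ (inj₁ (inj₂ (_ , e)))))) = inj₂ (inj₁ e)
diamondEdge-end D (inj₂ (inj₂ (inj₂ (inj₂ (inj₁ (_ , e)))))) = inj₂ (inj₂ (inj₂ e))
diamondEdge-end D (inj₂ (inj₂ (inj₂ (inj₂ (inj₂ (_ , e)))))) = inj₂ (inj₁ e)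

module _ {n : ℕ} (G : Graph n) where

  Adj? : ∀ i j → Dec (Adj G i j)
  Adj? i j = adj G i j Bool.≟ true

  Adj-sym : ∀ {i j} → Adj G i j → Adj G j i
  Adj-sym {i} {j} e = ≡.trans (sym G j i) e

  AddEdge-sym : ∀ {u v p q} → AddEdge (Adj G) u v p q → AddEdge (Adj G) u v q p
  AddEdge-sym (inj₁ e) = inj₁ (Adj-sym e)
  AddEdge-sym (inj₂ s) = inj₂ (SamePair-sym s)

  Adj⇒≢ : ∀ {i j} → Adj G i j → i ≢ j
  Adj⇒≢ {i} e refl with () ← ≡.trans (≡.sym e) (irrefl G i)

  ¬Adj⇒≡false : ∀ {i j} → ¬ Adj G i j → adj G i j ≡ false
  ¬Adj⇒≡false = Bool.¬-not

  commonNeighbour? : ∀ u v → Decidable (λ e → Adj G u e × Adj G v e)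
  commonNeighbour? u v e = Adj? u e ×-dec Adj? v e

  -- For distinct non-adjacent `u` and `v` this describes a new diamond using `uv` off its chord:
  -- the chord is `ub`, and `d` and `v` are the vertices of degree 2.
  MeetsTriangleAt : Fin n → Fin n → Set
  MeetsTriangleAt u v = ∃₂ λ b d → Adj G u b × Adj G u d × Adj G b d × Adj G v b

module Saturated {n : ℕ} (G : Graph n) (saturated : UniquelyDiamondSaturated G) where

  private
    E : (u v p q : Fin n) → Set
    E = AddEdge (Adj G)

    -- Both ends of the added edge lie in the pair `p`, `q`, so an edge ending at any other `s` was
    -- already present in `G`.
    old : ∀ {u v p q r s} → SamePair p q u v → s ≢ p → s ≢ q → E u v r s → Adj G r s
    old _                    _   _   (inj₁ e)               = e
    old (inj₁ (refl , refl)) _   s≢q (inj₂ (inj₁ (_ , e))) = contradiction e s≢q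
    old (inj₁ (refl , refl)) s≢p _   (inj₂ (inj₂ (_ , e))) = contradiction e s≢p
    old (inj₂ (refl , refl)) s≢p _   (inj₂ (inj₁ (_ , e))) = contradiction e s≢p
    old (inj₂ (refl , refl)) _   s≢q (inj₂ (inj₂ (_ , e))) = contradiction e s≢q

  module _ {u v : Fin n} (u≢v : u ≢ v) (u≁v : ¬ Adj G u v) where

    -- A third common neighbour `e` would give a second diamond with chord `uv`, on `c` and `e`. Its
    -- edge `ue` would have to belong to the diamond on `c` and `d`.
    unique-common : ∀ {c d e} → c ≢ d → Adj G u c × Adj G v c → Adj G u d × Adj G v d →
                    Adj G u e × Adj G v e → e ≡ c ⊎ e ≡ d
    unique-common {c} {d} {e} c≢d nc nd ne with e ≟ c
    ... | yes e≡c = inj₁ e≡c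
    ... | no  e≢c = inj₂ (conclude (diamondEdge-end D (sameSubgraph (proj₂ saturated u v u≢v u≁v) D′ D u e (inj₂ (inj₂ (inj₁ (inj₁ (refl , refl))))))))
      where
      chordDiamond : ∀ {r s} → r ≢ s → Adj G u r × Adj G v r → Adj G u s × Adj G v s → DiamondIn (E u v)
      chordDiamond {r} {s} r≢s (ur , vr) (us , vs) =
        diamond u v r s u≢v (Adj⇒≢ G ur) (Adj⇒≢ G us) (Adj⇒≢ G vr) (Adj⇒≢ G vs) r≢s
          (inj₂ (inj₁ (refl , refl))) (inj₁ ur) (inj₁ us) (inj₁ vr) (inj₁ vs)
      D D′ : DiamondIn (E u v)
      D  = chordDiamond c≢d nc nd
      D′ = chordDiamond (≢-sym e≢c) nc ne
      conclude : e ≡ u ⊎ e ≡ v ⊎ e ≡ c ⊎ e ≡ d → e ≡ d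
      conclude (inj₁ e≡u)               = contradiction (≡.sym e≡u) (Adj⇒≢ G (proj₁ ne))
      conclude (inj₂ (inj₁ e≡v))        = contradiction (≡.sym e≡v) (Adj⇒≢ G (proj₂ ne))
      conclude (inj₂ (inj₂ (inj₁ e≡c))) = contradiction e≡c e≢c
      conclude (inj₂ (inj₂ (inj₂ e≡d))) = e≡d

    -- The created diamond must use `uv`. As an outer edge it would leave a triangle of `G` at one
    -- end with a neighbour of the other end on it. So it is the chord, and the other two vertices
    -- are common neighbours.
    two-common : ¬ MeetsTriangleAt G u v → ¬ MeetsTriangleAt G v u → count (commonNeighbour? G u v) ≡ 2
    two-common ¬uv ¬vu with proj₂ saturated u v u≢v u≁v
    ... | diamond a b c d a≢b a≢c a≢d b≢c b≢d c≢d eab eac ead ebc ebd , _ = cases eab eac ead ebc ebd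
      where
      chord : SamePair a b u v → count (commonNeighbour? G u v) ≡ 2
      chord s = conclude s (old s (≢-sym a≢c) (≢-sym b≢c) eac) (old s (≢-sym a≢d) (≢-sym b≢d) ead)
                           (old s (≢-sym a≢c) (≢-sym b≢c) ebc) (old s (≢-sym a≢d) (≢-sym b≢d) ebd)
        where
        conclude : SamePair a b u v → Adj G a c → Adj G a d → Adj G b c → Adj G b d → count (commonNeighbour? G u v) ≡ 2
        conclude (inj₁ (refl , refl)) ac ad bc bd =
          count-two (commonNeighbour? G u v) c≢d (ac , bc) (ad , bd) (λ _ → unique-common c≢d (ac , bc) (ad , bd))
        conclude (inj₂ (refl , refl)) ac ad bc bd =
          count-two (commonNeighbour? G u v) c≢d (bc , ac) (bd , ad) (λ _ → unique-common c≢d (bc , ac) (bd , ad))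

      -- The chord is `pr`, the added edge is `pq`, and the triangle `p r s` survives in `G` with
      -- `q` adjacent to `r`.
      outer : ∀ {p q r s} → SamePair p q u v → r ≢ p → r ≢ q → s ≢ p → s ≢ q →
              E u v p r → E u v p s → E u v r s → E u v q r → count (commonNeighbour? G u v) ≡ 2
      outer {p} {q} {r} {s} pq r≢p r≢q s≢p s≢q pr ps rs qr =
        conclude pq (r , s , old pq r≢p r≢q pr , old pq s≢p s≢q ps , old pq s≢p s≢q rs , old pq r≢p r≢q qr)
        where
        conclude : SamePair p q u v → MeetsTriangleAt G p q → count (commonNeighbour? G u v) ≡ 2
        conclude (inj₁ (refl , refl)) m = contradiction m ¬uv
        conclude (inj₂ (refl , refl)) m = contradiction m ¬vu

      cases : E u v a b → E u v a c → E u v a d → E u v b c → E u v b d → count (commonNeighbour? G u v) ≡ 2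
      cases (inj₂ s) _ _ _ _ = chord s
      cases _ (inj₂ s) _ _ _ = outer s (≢-sym a≢b) b≢c (≢-sym a≢d) (≢-sym c≢d) eab ead ebd (AddEdge-sym G ebc)
      cases _ _ (inj₂ s) _ _ = outer s (≢-sym a≢b) b≢d (≢-sym a≢c) c≢d eab eac ebc (AddEdge-sym G ebd)
      cases _ _ _ (inj₂ s) _ = outer s a≢b a≢c (≢-sym b≢d) (≢-sym c≢d) (AddEdge-sym G eab) ebd ead (AddEdge-sym G eac)
      cases _ _ _ _ (inj₂ s) = outer s a≢b a≢d (≢-sym b≢c) c≢d (AddEdge-sym G eab) ebc eac (AddEdge-sym G ead)
      cases (inj₁ ab) (inj₁ ac) (inj₁ ad) (inj₁ bc) (inj₁ bd) =
        contradiction (diamond a b c d a≢b a≢c a≢d b≢c b≢d c≢d ab ac ad bc bd) (proj₁ saturated)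

    -- With two common neighbours b, e of u and v, the diamond with chord uv on
    -- b, e would differ from the one on the triangle u b d and v, as only the
    -- latter contains d.
    one-common : ∀ {b d e} → Adj G u b → Adj G u d → Adj G b d → Adj G v b → ¬ Adj G v d →
                 Adj G u e → Adj G v e → e ≡ b
    one-common {b} {d} {e} ub ud bd vb v≁d ue ve with e ≟ b
    ... | yes e≡b = e≡b
    ... | no  e≢b = contradiction
            (diamondEdge-end D′ (sameSubgraph (proj₂ saturated u v u≢v u≁v) D D′ u d (inj₂ (inj₁ (inj₁ (refl , refl))))))
            λ where
              (inj₁ d≡u)               → Adj⇒≢ G ud (≡.sym d≡u)
              (inj₂ (inj₁ d≡v))        → u≁v (subst (Adj G u) d≡v ud)
              (inj₂ (inj₂ (inj₁ d≡b))) → Adj⇒≢ G bd (≡.sym d≡b)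
              (inj₂ (inj₂ (inj₂ d≡e))) → v≁d (subst (Adj G v) (≡.sym d≡e) ve)
      where
      D D′ : DiamondIn (E u v)
      D = diamond u b d v (Adj⇒≢ G ub) (Adj⇒≢ G ud) u≢v (Adj⇒≢ G bd) (≢-sym (Adj⇒≢ G vb))
            (λ { refl → u≁v ud })
            (inj₁ ub) (inj₁ ud) (inj₂ (inj₁ (refl , refl))) (inj₁ bd) (inj₁ (Adj-sym G vb))
      D′ = diamond u v b e u≢v (Adj⇒≢ G ub) (Adj⇒≢ G ue) (Adj⇒≢ G vb) (Adj⇒≢ G ve) (≢-sym e≢b)
            (inj₂ (inj₁ (refl , refl))) (inj₁ ub) (inj₁ ue) (inj₁ vb) (inj₁ ve)

-- Graphs with a unique triangle

-- An ordered form of the unique triangle, so that the roles of `x`, `y`, `z` can be permuted. The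
-- field `only` speaks of the first vertex; reordering a triangle gives the other two.
record UniqueTriangle {n} (G : Graph n) (x y z : Fin n) : Set where
  field
    xy   : Adj G x y
    xz   : Adj G x z
    yz   : Adj G y z
    only : ∀ {p q r} → Adj G p q → Adj G p r → Adj G q r → p ≡ x ⊎ p ≡ y ⊎ p ≡ z

Outside : ∀ {n} → (x y z v : Fin n) → Set
Outside x y z v = v ≢ x × v ≢ y × v ≢ z

module _ {n : ℕ} (G : Graph n) where

  -- This is N(x) when `xyz` is the triangle; adjacency to `x` already excludes `x` itself.
  Pendant : (x y z v : Fin n) → Set
  Pendant x y z v = Adj G x v × v ≢ y × v ≢ z

  pendant? : ∀ x y z → Decidable (Pendant x y z)
  pendant? x y z v = Adj? G x v ×-dec (¬? (v ≟ y) ×-dec ¬? (v ≟ z))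

  pendant⇒outside : ∀ {x y z v} → Pendant x y z v → Outside x y z v
  pendant⇒outside (xv , v≢y , v≢z) = ≢-sym (Adj⇒≢ G xv) , v≢y , v≢z

module _ {n : ℕ} {G : Graph n} where

  swap₁₂ : ∀ {x y z} → UniqueTriangle G x y z → UniqueTriangle G y x z
  swap₁₂ T = record { xy = Adj-sym G xy ; xz = yz ; yz = xz
                    ; only = λ pq pr qr → [ inj₂ ∘ inj₁ , [ inj₁ , inj₂ ∘ inj₂ ]′ ]′ (only pq pr qr) }
    where open UniqueTriangle T

  swap₂₃ : ∀ {x y z} → UniqueTriangle G x y z → UniqueTriangle G x z y
  swap₂₃ T = record { xy = xz ; xz = xy ; yz = Adj-sym G yz
                    ; only = λ pq pr qr → [ inj₁ , inj₂ ∘ swap ]′ (only pq pr qr) }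
    where open UniqueTriangle T

  uniqueTriangle : ((T , _) : ExactlyOneTriangle G) → let open TriangleIn T in UniqueTriangle G x y z
  uniqueTriangle (triangle x y z exy exz eyz , unique) = record
    { xy = exy ; xz = exz ; yz = eyz
    ; only = λ {p} {q} {r} pq pr qr → from (unique (triangle p q r pq pr qr) p) (inj₁ refl) }

  module _ {x y z : Fin n} (T : UniqueTriangle G x y z) where
    open UniqueTriangle T

    outside⇒¬triangle : ∀ {p q r} → Outside x y z p → Adj G p q → Adj G p r → ¬ Adj G q r
    outside⇒¬triangle (p≢x , p≢y , p≢z) pq pr qr = [ p≢x , [ p≢y , p≢z ]′ ]′ (only pq pr qr)

    pendant-≁ : ∀ {v} → Pendant G x y z v → ¬ Adj G y v
    pendant-≁ nv@(xv , _) yv = outside⇒¬triangle (pendant⇒outside G nv) (Adj-sym G xv) (Adj-sym G yv) xy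

-- Common neighbours in a saturated graph with a unique triangle.

module _ {n : ℕ} {G : Graph n} (saturated : UniquelyDiamondSaturated G) where
  open Saturated G saturated

  -- Adding `yu` creates the diamond with chord `xy` on `z` and `u`, so `one-common` leaves no
  -- common neighbour besides `x`.
  pendant-common : ∀ {x y z u e} → UniqueTriangle G x y z → Pendant G x y z u → Adj G u e → Adj G y e → e ≡ x
  pendant-common T nu@(xu , u≢y , _) ue ye =
    one-common (≢-sym u≢y) (pendant-≁ T nu) (Adj-sym G xy) yz xz (Adj-sym G xu)
      (λ uz → outside⇒¬triangle T (pendant⇒outside G nu) (Adj-sym G xu) uz xz) ye ue
    where open UniqueTriangle T

  -- No triangle passes through `w`, and every triangle through `x` has its vertices among `x`, `y`,
  -- `z`, none of which is adjacent to `w`. Hence `two-common` applies.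
  far-common : ∀ {x y z w} → UniqueTriangle G x y z → Outside x y z w →
               ¬ Adj G w x → ¬ Adj G w y → ¬ Adj G w z → count (commonNeighbour? G w x) ≡ 2
  far-common {w = w} T out@(w≢x , _) w≁x w≁y w≁z =
    two-common w≢x w≁x
      (λ (_ , _ , wb , wd , bd , _) → outside⇒¬triangle T out wb wd bd)
      (λ (_ , _ , xb , xd , bd , wb) →
        [ (λ { refl → w≁x wb }) , [ (λ { refl → w≁y wb }) , (λ { refl → w≁z wb }) ]′ ]′ (only (Adj-sym G xb) bd xd))
    where open UniqueTriangle T

  outside-common : ∀ {x y z u v} → UniqueTriangle G x y z → Outside x y z u → Outside x y z v →
                   u ≢ v → ¬ Adj G u v → count (commonNeighbour? G u v) ≡ 2
  outside-common T ou ov u≢v u≁v =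
    two-common u≢v u≁v
      (λ (_ , _ , ub , ud , bd , _) → outside⇒¬triangle T ou ub ud bd)
      (λ (_ , _ , vb , vd , bd , _) → outside⇒¬triangle T ov vb vd bd)

  -- Double counting around a pendant vertex.

  module _ {x y z u : Fin n} (T : UniqueTriangle G x y z) (nu : Pendant G x y z u) where
    open UniqueTriangle T

    private
      xu : Adj G x u
      xu = proj₁ nu

      ou : Outside x y z u
      ou = pendant⇒outside G nu

      A : Pred (Fin n) 0ℓ
      A w = Adj G u w × w ≢ x

      A? : Decidable A
      A? = Adj? G u ∖ x

      others? : Decidable (λ v → Pendant G x y z v × v ≢ u)
      others? = pendant? G x y z ∖ u

      module _ {w : Fin n} (aw : A w) where

        private
          uw : Adj G u w
          uw = proj₁ aw

          w≢x : w ≢ x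
          w≢x = proj₂ aw

        -- A vertex of `A` has no neighbour on the triangle: `x` would close a triangle at `u`, and
        -- `y` or `z` would give a common neighbour with `u` other than `x`.
        far-x : ¬ Adj G w x
        far-x = outside⇒¬triangle T ou uw (Adj-sym G xu)

        far-y : ¬ Adj G w y
        far-y wy = w≢x (pendant-common T nu uw (Adj-sym G wy))

        far-z : ¬ Adj G w z
        far-z wz = w≢x (pendant-common (swap₂₃ T) (xu , proj₂ (proj₂ nu) , proj₁ (proj₂ nu)) uw (Adj-sym G wz))

        outside-A : Outside x y z w
        outside-A = w≢x
                  , (λ { refl → pendant-≁ T nu (Adj-sym G uw) })
                  , (λ { refl → far-y (Adj-sym G yz) })

        -- Of the two common neighbours of `w` and `x`, one is `u`; the other is a pendant at `x`.
        row-x : count (λ v → others? v ×-dec Adj? G w v) ≡ 1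
        row-x = ≡.trans
          (count-cong (λ v → others? v ×-dec Adj? G w v) (commonNeighbour? G w x ∖ u)
            (λ (((xv , _) , v≢u) , wv) → (wv , xv) , v≢u)
            (λ ((wv , xv) , v≢u) → ((xv , (λ { refl → far-y wv }) , (λ { refl → far-z wv })) , v≢u) , wv))
          (suc-injective (≡.trans (≡.sym (count-remove (commonNeighbour? G w x) (Adj-sym G uw , xu)))
                                  (far-common T outside-A far-x far-y far-z)))

        -- Both common neighbours of `w` and `y` are pendants at `y`, since `w` is adjacent to
        -- neither `x` nor `z`.
        row-y : count (λ v → pendant? G y x z v ×-dec Adj? G w v) ≡ 2
        row-y = ≡.trans
          (count-cong (λ v → pendant? G y x z v ×-dec Adj? G w v) (commonNeighbour? G w y)
            (λ ((yv , _) , wv) → wv , yv)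
            (λ (wv , yv) → (yv , (λ { refl → far-x wv }) , (λ { refl → far-z wv })) , wv))
          (far-common (swap₁₂ T) (proj₁ (proj₂ outside-A) , proj₁ outside-A , proj₂ (proj₂ outside-A)) far-y far-x far-z)

      -- Of the two common neighbours of `u` and `v`, one is `x`, which `A` leaves out.
      column-x : ∀ {v} → Pendant G x y z v × v ≢ u → count (λ w → A? w ×-dec Adj? G w v) ≡ 1
      column-x {v} (nv@(xv , _) , v≢u) = ≡.trans
        (count-cong (λ w → A? w ×-dec Adj? G w v) (commonNeighbour? G u v ∖ x)
          (λ ((uw , w≢x) , wv) → (uw , Adj-sym G wv) , w≢x)
          (λ ((uw , vw) , w≢x) → (uw , w≢x) , Adj-sym G vw))
        (suc-injective (≡.trans (≡.sym (count-remove (commonNeighbour? G u v) (Adj-sym G xu , Adj-sym G xv)))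
          (outside-common T ou (pendant⇒outside G nv) (≢-sym v≢u)
            (λ uv → outside⇒¬triangle T ou (Adj-sym G xu) uv xv))))

      -- Here `x` is not adjacent to `v`, so both common neighbours of `u` and `v` lie in `A`. An
      -- edge `uv` would make `v` a common neighbour of `u` and `y`.
      column-y : ∀ {v} → Pendant G y x z v → count (λ w → A? w ×-dec Adj? G w v) ≡ 2
      column-y {v} nv@(yv , v≢x , v≢z) = ≡.trans
        (count-cong (λ w → A? w ×-dec Adj? G w v) (commonNeighbour? G u v)
          (λ ((uw , _) , wv) → uw , Adj-sym G wv)
          (λ (uw , vw) → (uw , (λ { refl → pendant-≁ (swap₁₂ T) nv (Adj-sym G vw) })) , Adj-sym G vw))
        (outside-common T ou (v≢x , ≢-sym (Adj⇒≢ G yv) , v≢z)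
          (λ { refl → pendant-≁ T nu yv })
          (λ uv → v≢x (pendant-common T nu uv yv)))

    -- Both sides equal the size of `A`, after cancelling the factors 1 and 2 from the two double
    -- counts.
    count-other-pendants : count others? ≡ count (pendant? G y x z)
    count-other-pendants = ≡.trans (≡.sym (*-cancelʳ-≡ (count A?) _ 1 (double-count A? others? (Adj? G) (λ _ → row-x) (λ _ → column-x))))
      (*-cancelʳ-≡ (count A?) _ 2 (double-count A? (pendant? G y x z) (Adj? G) (λ _ → row-y) (λ _ → column-y)))

    count-pendants : count (pendant? G x y z) ≡ suc (count (pendant? G y x z))
    count-pendants = ≡.trans (count-remove (pendant? G x y z) nu) (cong suc count-other-pendants)

  ¬two-pendants : ∀ {x y z u v} → UniqueTriangle G x y z → Pendant G x y z u → ¬ Pendant G y x z v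
  -- Applying the count at both vertices gives |N(x)| = 2 + |N(x)|.
  ¬two-pendants T nu nv = m≢1+n+m _ {1} (≡.trans (count-pendants T nu) (cong suc (count-pendants (swap₁₂ T) nv)))

  far-pendant : ∀ {x y z w} → UniqueTriangle G x y z → Outside x y z w →
                ¬ Adj G w x → ¬ Adj G w y → ¬ Adj G w z → ∃ (Pendant G x y z)
  far-pendant {x} {w = w} T out w≁x w≁y w≁z with count≡suc⇒∃ (commonNeighbour? G w x) (far-common T out w≁x w≁y w≁z)
  ... | c , wc , xc = c , xc , (λ { refl → w≁y wc }) , (λ { refl → w≁z wc })

  -- A vertex with no neighbour on the triangle would force pendants at both `x` and `y`.
  ¬far : ∀ {x y z w} → UniqueTriangle G x y z → Outside x y z w →
         ¬ Adj G w x → ¬ Adj G w y → ¬ ¬ Adj G w z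
  ¬far T out@(w≢x , w≢y , w≢z) w≁x w≁y w≁z =
    ¬two-pendants T (proj₂ (far-pendant T out w≁x w≁y w≁z))
                    (proj₂ (far-pendant (swap₁₂ T) (w≢y , w≢x , w≢z) w≁y w≁x w≁z))

  -- N(y) is empty, so N(x) without `u`, having the same size, is empty too.
  pendant-unique : ∀ {x y z u v} → UniqueTriangle G x y z → Pendant G x y z u → Pendant G x y z v → v ≡ u
  pendant-unique {x} {y} {z} {u} {v} T nu nv with v ≟ u
  ... | yes v≡u = v≡u
  ... | no  v≢u = contradiction (nv , v≢u)
    (count≡0⇒empty (pendant? G x y z ∖ u)
      (≡.trans (count-other-pendants T nu) (count-none (pendant? G y x z) (λ _ → ¬two-pendants T nu))) v)

  -- The isomorphism with `C3*`.

  module _ {x y z u : Fin n} (T : UniqueTriangle G x y z) (nu : Pendant G x y z u) where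
    open UniqueTriangle T

    -- The order puts `x` at index 2, where `C3*` carries its pendant edge.
    vertex : Fin 4 → Fin n
    vertex = lookup (y ∷ z ∷ x ∷ u ∷ [])

    private
      nu′ : Pendant G x z y u
      nu′ = proj₁ nu , proj₂ (proj₂ nu) , proj₁ (proj₂ nu)

    outside⇒pendant : ∀ {v} → Outside x y z v → v ≡ u
    outside⇒pendant {v} out@(v≢x , v≢y , v≢z) with Adj? G v x | Adj? G v y | Adj? G v z
    ... | yes vx | _      | _      = pendant-unique T nu (Adj-sym G vx , v≢y , v≢z)
    ... | no _   | yes vy | _      = contradiction (Adj-sym G vy , v≢x , v≢z) (¬two-pendants T nu)
    ... | no _   | no _   | yes vz = contradiction (Adj-sym G vz , v≢x , v≢y) (¬two-pendants (swap₂₃ T) nu′)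
    ... | no v≁x | no v≁y | no v≁z = contradiction v≁z (¬far T out v≁x v≁y)

    position : ∀ v → ∃ λ i → vertex i ≡ v
    position v with v ≟ y | v ≟ z | v ≟ x
    ... | yes v≡y | _       | _       = 0F , ≡.sym v≡y
    ... | no _    | yes v≡z | _       = 1F , ≡.sym v≡z
    ... | no _    | no _    | yes v≡x = 2F , ≡.sym v≡x
    ... | no v≢y  | no v≢z  | no v≢x  = 3F , ≡.sym (outside⇒pendant (v≢x , v≢y , v≢z))

    vertex-adj : ∀ i j → c3*-adj i j ≡ adj G (vertex i) (vertex j)
    vertex-adj 0F 0F = ≡.sym (irrefl G y)
    vertex-adj 0F 1F = ≡.sym yz
    vertex-adj 0F 2F = ≡.sym (Adj-sym G xy)
    vertex-adj 0F 3F = ≡.sym (¬Adj⇒≡false G (pendant-≁ T nu))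
    vertex-adj 1F 0F = ≡.sym (Adj-sym G yz)
    vertex-adj 1F 1F = ≡.sym (irrefl G z)
    vertex-adj 1F 2F = ≡.sym (Adj-sym G xz)
    vertex-adj 1F 3F = ≡.sym (¬Adj⇒≡false G (pendant-≁ (swap₂₃ T) nu′))
    vertex-adj 2F 0F = ≡.sym xy
    vertex-adj 2F 1F = ≡.sym xz
    vertex-adj 2F 2F = ≡.sym (irrefl G x)
    vertex-adj 2F 3F = ≡.sym (proj₁ nu)
    vertex-adj 3F 0F = ≡.sym (¬Adj⇒≡false G (pendant-≁ T nu ∘ Adj-sym G))
    vertex-adj 3F 1F = ≡.sym (¬Adj⇒≡false G (pendant-≁ (swap₂₃ T) nu′ ∘ Adj-sym G))
    vertex-adj 3F 2F = ≡.sym (Adj-sym G (proj₁ nu))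
    vertex-adj 3F 3F = ≡.sym (irrefl G u)

    vertex-injective : ∀ i j → vertex i ≡ vertex j → i ≡ j
    vertex-injective 0F 0F _ = refl
    vertex-injective 0F 1F e = contradiction e (Adj⇒≢ G yz)
    vertex-injective 0F 2F e = contradiction (≡.sym e) (Adj⇒≢ G xy)
    vertex-injective 0F 3F e = contradiction (≡.sym e) (proj₁ (proj₂ nu))
    vertex-injective 1F 1F _ = refl
    vertex-injective 1F 2F e = contradiction (≡.sym e) (Adj⇒≢ G xz)
    vertex-injective 1F 3F e = contradiction (≡.sym e) (proj₂ (proj₂ nu))
    vertex-injective 2F 2F _ = refl
    vertex-injective 2F 3F e = contradiction e (Adj⇒≢ G (proj₁ nu))
    vertex-injective 3F 3F _ = refl
    vertex-injective 1F 0F e = ≡.sym (vertex-injective 0F 1F (≡.sym e))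
    vertex-injective 2F 0F e = ≡.sym (vertex-injective 0F 2F (≡.sym e))
    vertex-injective 2F 1F e = ≡.sym (vertex-injective 1F 2F (≡.sym e))
    vertex-injective 3F 0F e = ≡.sym (vertex-injective 0F 3F (≡.sym e))
    vertex-injective 3F 1F e = ≡.sym (vertex-injective 1F 3F (≡.sym e))
    vertex-injective 3F 2F e = ≡.sym (vertex-injective 2F 3F (≡.sym e))

    pendant⇒≅C3* : G ≅ C3*
    pendant⇒≅C3* =
      mk↔ₛ′ (proj₁ ∘ position) vertex (λ i → vertex-injective _ _ (proj₂ (position (vertex i)))) (proj₂ ∘ position) ,
      λ i j → ≡.trans (vertex-adj _ _) (cong₂ (adj G) (proj₂ (position i)) (proj₂ (position j)))

  outside⇒≅C3* : ∀ {x y z v} → UniqueTriangle G x y z → Outside x y z v → G ≅ C3*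
  outside⇒≅C3* {x} {y} {z} {v} T out@(v≢x , v≢y , v≢z) with Adj? G v x | Adj? G v y | Adj? G v z
  ... | yes vx | _      | _      = pendant⇒≅C3* T (Adj-sym G vx , v≢y , v≢z)
  ... | no _   | yes vy | _      = pendant⇒≅C3* (swap₁₂ T) (Adj-sym G vy , v≢x , v≢z)
  ... | no _   | no _   | yes vz = pendant⇒≅C3* (swap₁₂ (swap₂₃ T)) (Adj-sym G vz , v≢x , v≢y)
  ... | no v≁x | no v≁y | no v≁z = contradiction v≁z (¬far T out v≁x v≁y)

-- Pigeonhole: otherwise `Fin n` would inject into `Fin 3`.
fourth-vertex : ∀ {n} → 4 ≤ n → (x y z : Fin n) → ∃ (Outside x y z)
fourth-vertex 4≤n x y z with any? (λ v → ¬? (v ≟ x) ×-dec (¬? (v ≟ y) ×-dec ¬? (v ≟ z)))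
... | yes v = v
... | no ¬v = contradiction (≤-trans 4≤n (injective⇒≤ index-injective)) 1+n≰n
  where
  index : ∀ v → ∃ λ i → lookup (x ∷ y ∷ z ∷ []) i ≡ v
  index v with v ≟ x | v ≟ y | v ≟ z
  ... | yes v≡x | _       | _       = 0F , ≡.sym v≡x
  ... | no _    | yes v≡y | _       = 1F , ≡.sym v≡y
  ... | no _    | no _    | yes v≡z = 2F , ≡.sym v≡z
  ... | no v≢x  | no v≢y  | no v≢z  = contradiction (v , v≢x , v≢y , v≢z) ¬v
  index-injective : ∀ {v w} → proj₁ (index v) ≡ proj₁ (index w) → v ≡ w
  index-injective {v} {w} eq =
    ≡.trans (≡.sym (proj₂ (index v))) (≡.trans (cong (lookup (x ∷ y ∷ z ∷ [])) eq) (proj₂ (index w)))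

-- The graph C₃*

module _ {n : ℕ} where

  -- A product form of `DiamondIn`, with the vertices as parameters, so that decision procedures can
  -- be assembled for it.
  DiamondOn : (Fin n → Fin n → Set) → (a b c d : Fin n) → Set
  DiamondOn R a b c d = (a ≢ b × a ≢ c × a ≢ d × b ≢ c × b ≢ d × c ≢ d) × (R a b × R a c × R a d × R b c × R b d)

  diamondOn : ∀ {R} (D : DiamondIn R) → let open DiamondIn D in DiamondOn R a b c d
  diamondOn (diamond _ _ _ _ ab ac ad bc bd cd eab eac ead ebc ebd) =
    (ab , ac , ad , bc , bd , cd) , (eab , eac , ead , ebc , ebd)

  fromDiamondOn : ∀ {R a b c d} → DiamondOn R a b c d → DiamondIn R
  fromDiamondOn ((ab , ac , ad , bc , bd , cd) , (eab , eac , ead , ebc , ebd)) =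
    diamond _ _ _ _ ab ac ad bc bd cd eab eac ead ebc ebd

  EdgeOf : (a b c d p q : Fin n) → Set
  EdgeOf a b c d p q = SamePair p q a b ⊎ SamePair p q a c ⊎ SamePair p q a d ⊎ SamePair p q b c ⊎ SamePair p q b d

  SomeDiamond : (Fin n → Fin n → Set) → Set
  SomeDiamond R = ∃ λ a → ∃ λ b → ∃ λ c → ∃ λ d → DiamondOn R a b c d

  -- Suited to `C3*`: with one edge added it has five edges, as many as a diamond, so each diamond
  -- uses all of them.
  AllEdges : (Fin n → Fin n → Set) → Set
  AllEdges R = ∀ a b c d → DiamondOn R a b c d → ∀ p q → R p q → EdgeOf a b c d p q

  SamePair? : ∀ p q u v → Dec (SamePair {n} p q u v)
  SamePair? p q u v = ((p ≟ u) ×-dec (q ≟ v)) ⊎-dec ((p ≟ v) ×-dec (q ≟ u))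

  EdgeOf? : ∀ a b c d p q → Dec (EdgeOf a b c d p q)
  EdgeOf? a b c d p q = SamePair? p q a b ⊎-dec (SamePair? p q a c ⊎-dec (SamePair? p q a d ⊎-dec (SamePair? p q b c ⊎-dec SamePair? p q b d)))

  module _ {R : Fin n → Fin n → Set} (R? : ∀ p q → Dec (R p q)) where

    diamondOn? : ∀ a b c d → Dec (DiamondOn R a b c d)
    diamondOn? a b c d =
      (¬? (a ≟ b) ×-dec (¬? (a ≟ c) ×-dec (¬? (a ≟ d) ×-dec (¬? (b ≟ c) ×-dec (¬? (b ≟ d) ×-dec ¬? (c ≟ d))))))
      ×-dec (R? a b ×-dec (R? a c ×-dec (R? a d ×-dec (R? b c ×-dec R? b d))))

    allEdges? : Dec (AllEdges R)
    allEdges? = all? λ a → all? λ b → all? λ c → all? λ d → diamondOn? a b c d →-dec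
                  (all? λ p → all? λ q → R? p q →-dec EdgeOf? a b c d p q)

    anyDiamond? : Dec (SomeDiamond R)
    anyDiamond? = any? λ a → any? λ b → any? λ c → any? λ d → diamondOn? a b c d

  diamondEdge⇒R : ∀ {R : Fin n → Fin n → Set} → (∀ {p q} → R p q → R q p) → (D : DiamondIn R) → ∀ p q → DiamondEdge D p q → R p q
  diamondEdge⇒R {R} R-sym D p q = [ edge eab , [ edge eac , [ edge ead , [ edge ebc , edge ebd ]′ ]′ ]′ ]′
    where
    open DiamondIn D
    edge : ∀ {r s} → R r s → SamePair p q r s → R p q
    edge e (inj₁ (refl , refl)) = e
    edge e (inj₂ (refl , refl)) = R-sym e

  -- Every diamond has all of `R` as its edge set, so any two have the same edges.
  exactlyOneDiamond : ∀ {R : Fin n → Fin n → Set} → (∀ {p q} → R p q → R q p) →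
                      SomeDiamond R → AllEdges R → ExactlyOneDiamond R
  exactlyOneDiamond R-sym (_ , _ , _ , _ , D) allEdges = fromDiamondOn D , λ D′ p q →
    mk⇔ (allEdges _ _ _ _ (diamondOn D′) p q ∘ diamondEdge⇒R R-sym (fromDiamondOn D) p q)
        (allEdges _ _ _ _ D p q ∘ diamondEdge⇒R R-sym D′ p q)

addEdge? : ∀ {n} (G : Graph n) u v p q → Dec (AddEdge (Adj G) u v p q)
addEdge? G u v p q = Adj? G p q ⊎-dec SamePair? p q u v

C3*-diamondFree : DiamondFree C3*
C3*-diamondFree D = toWitnessFalse {a? = anyDiamond? (Adj? C3*)} _ (_ , _ , _ , _ , diamondOn D)

-- Settled by evaluating the decision procedure over all vertices of `C3*`.
C3*-addEdge : ∀ u v → u ≢ v → ¬ Adj C3* u v →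
              SomeDiamond (AddEdge (Adj C3*) u v) × AllEdges (AddEdge (Adj C3*) u v)
C3*-addEdge = toWitness {a? = all? λ u → all? λ v → ¬? (u ≟ v) →-dec (¬? (Adj? C3* u v) →-dec
                (anyDiamond? (addEdge? C3* u v) ×-dec allEdges? (addEdge? C3* u v)))} _

C3*-saturated : ∀ u v → u ≢ v → ¬ Adj C3* u v → ExactlyOneDiamond (AddEdge (Adj C3*) u v)
C3*-saturated u v u≢v u≁v = exactlyOneDiamond (AddEdge-sym C3*) (proj₁ (C3*-addEdge u v u≢v u≁v)) (proj₂ (C3*-addEdge u v u≢v u≁v))

C3*-triangle : ExactlyOneTriangle C3*
C3*-triangle = triangle 0F 1F 2F refl refl refl , λ (triangle x y z exy exz eyz) w →
  let f , g = toWitness {a? = all? λ x → all? λ y → all? λ z → Adj? C3* x y →-dec (Adj? C3* x z →-dec (Adj? C3* y z →-dec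
                (all? λ w → (∈? w 0F 1F 2F →-dec ∈? w x y z) ×-dec (∈? w x y z →-dec ∈? w 0F 1F 2F))))} _ x y z exy exz eyz w
  in mk⇔ f g
  where
  ∈? : ∀ (w x y z : Fin 4) → Dec (w ≡ x ⊎ w ≡ y ⊎ w ≡ z)
  ∈? w x y z = (w ≟ x) ⊎-dec ((w ≟ y) ⊎-dec (w ≟ z))

theorem3p6 : (Nontrivial C3* × UniquelyDiamondSaturated C3* × ExactlyOneTriangle C3*)
    × (∀ (n : ℕ) (G : Graph n) → Nontrivial G → UniquelyDiamondSaturated G → ExactlyOneTriangle G → G ≅ C3*)
theorem3p6 =
  (s≤s (s≤s (s≤s (s≤s z≤n))) , (C3*-diamondFree , C3*-saturated) , C3*-triangle) ,
  λ n G 4≤n saturated one@(triangle x y z _ _ _ , _) →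
    outside⇒≅C3* saturated (uniqueTriangle one) (proj₂ (fourth-vertex 4≤n x y z))
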